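{- Let $n \geq 1$ and let $y_1, \dots, y_n$ be positive integers. The number $f(\vec{y})$ of parking sequences for the car sizes $\vec{y} = (y_1, \dots, y_n)$ is \[ f(\vec{y}) = (y_1 + n)\cdot(y_1 + y_2 + n - 1)\cdots(y_1 + \cdots + y_{n-1} + 2) = \prod_{i=1}^{n-1}\Big(\sum_{j=1}^{i} y_j + n + 1 - i\Big), \] with the empty product equal to $1$ when $n = 1$.
   Context: Parking sequences. There are $n$ cars $C_1, \dots, C_n$ of sizes $y_1, \dots, y_n$ (positive integers). There are $\sum_{i=1}^n y_i$ parking spaces in a row, numbered $1, 2, \dots, \sum_{i=1}^n y_i$. Car $C_i$ has a preferred spot $c_i$, a positive integer. The cars park one at a time, in the order $C_1, C_2, \dots, C_n$, by the following rule. Car $C_i$ starts at position $c_i$ and finds the first empty spot $j \geq c_i$. If spots $j, j+1, \dots, j + y_i - 1$ are all empty, the car occupies these spots. If one of the spots $j+1, \dots, j+y_i-1$ is already occupied, a collision occurs. The sequence $(c_1, \dots, c_n)$ is a parking sequence for $\vec{y} = (y_1, \dots, y_n)$ if all $n$ cars park with no collision and no car leaves the $\sum_{i=1}^n y_i$ spaces. A car leaves the spaces if it finds no empty spot $j \geq c_i$, or if its occupied spots would extend past spot $\sum_{i=1}^n y_i$. The number $f(\vec{y})$ counts the sequences $(c_1, \dots, c_n)$ of positive integers that are parking sequences for $\vec{y}$. -}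

module Defs where

open import Data.Nat using (ℕ; zero; suc; _+_; _*_; _∸_; _≤ᵇ_; _<ᵇ_)
open import Data.Bool using (Bool; true; false; if_then_else_; _∨_; _∧_; not)
open import Data.Maybe using (Maybe; just; nothing)
open import Data.List using (List; map; applyUpTo; take)
open import Data.Nat.ListAction using (sum; product)
open import Data.Vec using (Vec; []; _∷_; toList)

-- An occupancy state of the row of parking spots: spot k (1-indexed) is
-- occupied iff the function returns true.  Initially nothing is occupied.
Occupancy : Set
Occupancy = ℕ → Bool

empty : Occupancy
empty _ = false

firstEmpty : Occupancy → ℕ → ℕ → Maybe ℕ
firstEmpty occ k zero    = nothing
firstEmpty occ k (suc f) = if occ k then firstEmpty occ (suc k) f else just k

allFree : Occupancy → ℕ → ℕ → Bool
allFree occ j zero    = true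
allFree occ j (suc s) = not (occ j) ∧ allFree occ (suc j) s

occupy : Occupancy → ℕ → ℕ → Occupancy
occupy occ j s k = occ k ∨ ((j ≤ᵇ k) ∧ (k <ᵇ j + s))

-- Park one car of size s with preferred spot c in a row of S spots.
-- Fails (nothing) if c is not a positive integer, if no empty spot j ≥ c
-- exists among 1..S, if a collision occurs, or if the car would extend past S.
parkCar : ℕ → Occupancy → ℕ → ℕ → Maybe Occupancy
parkCar S occ zero    s = nothing
parkCar S occ (suc c) s with firstEmpty occ (suc c) (S ∸ c)
... | nothing = nothing
... | just j  = if allFree occ j s ∧ (j + s ≤ᵇ suc S)
                  then just (occupy occ j s) else nothing

parkAll : ℕ → Occupancy → {n : ℕ} → Vec ℕ n → Vec ℕ n → Bool
parkAll S occ []       []       = true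
parkAll S occ (y ∷ ys) (c ∷ cs) with parkCar S occ c y
... | nothing   = false
... | just occ′ = parkAll S occ′ ys cs

isParkingSeq : {n : ℕ} → Vec ℕ n → Vec ℕ n → Bool
isParkingSeq ys cs = parkAll (sum (toList ys)) empty ys cs

prefixSum : {n : ℕ} → Vec ℕ n → ℕ → ℕ
prefixSum ys i = sum (take i (toList ys))

parkingFormula : {n : ℕ} → Vec ℕ n → ℕ
parkingFormula {n} ys =
  product (map (λ i → prefixSum ys i + (n + 1 ∸ i)) (applyUpTo suc (n ∸ 1)))

{-# OPTIONS --safe #-}

-- If the first car leaves a block of length y behind, then in every completed parking this
-- block is followed by some later car r or by the right end. Deleting the block and letting
-- car r carry it along turns the count into one for fewer cars, where car r is longer by y
-- and has y additional preferences. Summing over r (and the right end) gives a recursion for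
-- the number of parkings of cars with prescribed sizes and prescribed numbers of
-- preferences; the closed form is a product (arrangements), and for the original cars it is
-- the product in question. The recursion needs the spots that a car takes to be counted apart
-- from the length that it adds to a block, because only the latter changes.

module Submission where

open import Defs
open import Data.Nat using (ℕ; zero; suc; _+_; _*_; _∸_; _≤_; _<_; _≤ᵇ_; z≤n; s≤s)
open import Data.Nat.Properties
open import Data.Nat.Tactic.RingSolver using (solve-∀)
open import Data.Nat.ListAction using (sum; product)
open import Data.Bool using (true; false; T; not; _∧_; if_then_else_)
open import Data.Bool.Properties using (∨-identityʳ; ∨-zeroʳ; ∧-zeroʳ)
open import Data.Maybe using (Maybe; just; nothing; maybe′)
open import Data.List using (List; []; _∷_; length; replicate; applyUpTo)
open import Data.List.Properties using (map-applyUpTo; length-replicate)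
open import Data.Vec using (Vec; []; _∷_; toList)
open import Data.Vec.Relation.Unary.All using (All; []; _∷_)
open import Data.Fin using (Fin)
open import Data.Fin.Properties using (+↔⊎; 1↔⊤)
open import Data.Unit using (tt)
open import Data.Empty using (⊥-elim)
open import Data.Product using (Σ; _,_; proj₂)
open import Data.Sum using (_⊎_; inj₁; inj₂)
open import Data.Sum.Function.Propositional using (_⊎-↔_)
open import Function using (_∘_)
open import Function.Bundles using (_↔_; mk↔ₛ′)
open import Function.Properties.Inverse using (↔-refl; ↔-sym; ↔-trans)
open import Relation.Nullary using (¬_)
open import Relation.Nullary.Decidable using (dec-true; dec-false)
open import Relation.Binary.PropositionalEquality

private variable A : Set

-- Sums over the choice of one list entry to modify.

sumUpdates : (A → A) → List A → (List A → ℕ) → ℕ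
sumUpdates f []       h = 0
sumUpdates f (x ∷ xs) h = h (f x ∷ xs) + sumUpdates f xs (h ∘ (x ∷_))

sumUpdates-+ : (f : A → A) (xs : List A) (g h : List A → ℕ) →
  sumUpdates f xs (λ l → g l + h l) ≡ sumUpdates f xs g + sumUpdates f xs h
sumUpdates-+ f []       g h = refl
sumUpdates-+ f (x ∷ xs) g h
  rewrite sumUpdates-+ f xs (g ∘ (x ∷_)) (h ∘ (x ∷_)) =
  +-interchange (g (f x ∷ xs)) (h (f x ∷ xs)) _ _
  where
  +-interchange : ∀ a b c d → a + b + (c + d) ≡ a + c + (b + d)
  +-interchange = solve-∀

sumUpdates-* : (f : A → A) (xs : List A) (k : ℕ) (h : List A → ℕ) →
  sumUpdates f xs (λ l → k * h l) ≡ k * sumUpdates f xs h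
sumUpdates-* f []       k h = sym (*-zeroʳ k)
sumUpdates-* f (x ∷ xs) k h
  rewrite sumUpdates-* f xs k (h ∘ (x ∷_)) = sym (*-distribˡ-+ k (h (f x ∷ xs)) _)

sumUpdates-0 : (f : A → A) (xs : List A) → sumUpdates f xs (λ _ → 0) ≡ 0
sumUpdates-0 f []       = refl
sumUpdates-0 f (x ∷ xs) = sumUpdates-0 f xs

-- Rows of spots and the parking of one car.

-- A row of spots is recorded by listing, for each free spot from left to right,
-- the length of the run of occupied spots immediately before it; a run reaching
-- the right end is dropped, since no car can ever profit from it.
Gaps : Set
Gaps = List ℕ

-- Each spot after a car's first one must be free with no run before it, hence an entry `zero`.
strip : ℕ → Gaps → Maybe Gaps
strip zero    xs           = just xs
strip (suc w) []           = nothing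
strip (suc w) (zero ∷ xs)  = strip w xs
strip (suc w) (suc x ∷ xs) = nothing

-- With no free spot left, the run reaches the right end and is dropped.
bump : ℕ → Gaps → Gaps
bump c []       = []
bump c (x ∷ xs) = x + c ∷ xs

placeFirst : (a w y x : ℕ) → Gaps → (Gaps → ℕ) → ℕ
placeFirst a w y x xs h = maybe′ (λ t → (a + x) * h (bump (x + y) t)) 0 (strip w xs)

-- The car takes suc w consecutive free spots but lengthens the run it joins by y,
-- and a start preceded by a run of length x is counted a + x times.
place : (a w y : ℕ) → Gaps → (Gaps → ℕ) → ℕ
place a w y []       h = 0
place a w y (x ∷ xs) h = placeFirst a w y x xs h + place a w y xs (h ∘ (x ∷_))

strip-length : ∀ w xs {t} → strip w xs ≡ just t → w + length t ≡ length xs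
strip-length zero    xs          refl = refl
strip-length (suc w) (zero ∷ xs) e    = cong suc (strip-length w xs e)

bump-length : ∀ c xs → length (bump c xs) ≡ length xs
bump-length c []       = refl
bump-length c (x ∷ xs) = refl

place-cong : ∀ a w y b {g h : Gaps → ℕ} →
  (∀ l → suc w + length l ≡ length b → g l ≡ h l) → place a w y b g ≡ place a w y b h
place-cong a w y []       e = refl
place-cong a w y (x ∷ xs) {g} {h} e =
  cong₂ _+_ first (place-cong a w y xs (λ l p → e (x ∷ l) (cong suc (trans (+-suc w _) p))))
  where
  first : placeFirst a w y x xs g ≡ placeFirst a w y x xs h
  first with strip w xs in eq
  ... | nothing = refl
  ... | just t  = cong ((a + x) *_) (e _ (cong suc
        (trans (cong (w +_) (bump-length (x + y) t)) (strip-length w xs eq))))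

place-+ : ∀ a w y b (g h : Gaps → ℕ) →
  place a w y b (λ l → g l + h l) ≡ place a w y b g + place a w y b h
place-+ a w y []       g h = refl
place-+ a w y (x ∷ xs) g h rewrite place-+ a w y xs (g ∘ (x ∷_)) (h ∘ (x ∷_)) = first
  where
  lem : ∀ k p q c d → k * (p + q) + (c + d) ≡ k * p + c + (k * q + d)
  lem = solve-∀
  first : placeFirst a w y x xs (λ l → g l + h l) + (place a w y xs (g ∘ (x ∷_)) + place a w y xs (h ∘ (x ∷_)))
    ≡ placeFirst a w y x xs g + place a w y xs (g ∘ (x ∷_)) + (placeFirst a w y x xs h + place a w y xs (h ∘ (x ∷_)))
  first with strip w xs
  ... | nothing = refl
  ... | just t  = lem (a + x) (g (bump (x + y) t)) _ _ _

place-0 : ∀ a w y b → place a w y b (λ _ → 0) ≡ 0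
place-0 a w y []       = refl
place-0 a w y (x ∷ xs) with strip w xs
... | nothing = place-0 a w y xs
... | just t  rewrite *-zeroʳ (a + x) = place-0 a w y xs

-- A block before one of the `w` stripped spots would stop the car, so only entries beyond them
-- contribute, and there adding the block commutes with `bump`.
sumUpdates-placeFirst : ∀ z a w y x xs h →
  sumUpdates (_+ suc z) xs (λ l → placeFirst a w y x l h) ≡
  placeFirst a w y x xs (λ l → sumUpdates (_+ suc z) l h)
sumUpdates-placeFirst z a zero    y x []       h = sym (*-zeroʳ (a + x))
sumUpdates-placeFirst z a zero    y x (t ∷ ts) h =
  trans (cong₂ _+_ (cong (λ c → (a + x) * h (c ∷ ts)) (swap t (suc z) (x + y)))
                   (sumUpdates-* (_+ suc z) ts (a + x) (h ∘ (t + (x + y) ∷_))))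
        (sym (*-distribˡ-+ (a + x) (h (t + (x + y) + suc z ∷ ts)) _))
  where
  swap : ∀ t z c → t + z + c ≡ t + c + z
  swap = solve-∀
sumUpdates-placeFirst z a (suc w) y x []           h = refl
sumUpdates-placeFirst z a (suc w) y x (zero ∷ xs)  h = sumUpdates-placeFirst z a w y x xs h
sumUpdates-placeFirst z a (suc w) y x (suc t ∷ xs) h = sumUpdates-0 (_+ suc z) xs

-- A block of length suc z sits either immediately before the spot where the car parks,
-- and is then absorbed into the car, or elsewhere, and then survives the parking.
sumUpdates-place : ∀ z a w y b h →
  sumUpdates (_+ suc z) b (λ l → place a w y l h) ≡
  place (a + suc z) w (y + suc z) b h + place a w y b (λ l → sumUpdates (_+ suc z) l h)
sumUpdates-place z a w y []       h = refl
sumUpdates-place z a w y (x ∷ xs) h =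
  begin
    placeFirst a w y (x + suc z) xs h + p₁
      + sumUpdates u xs (λ l → placeFirst a w y x l h + place a w y l hx)
  ≡⟨ cong₂ _+_ (cong (_+ p₁) first) (sumUpdates-+ u xs _ _) ⟩
    f + p₁ + (sumUpdates u xs (λ l → placeFirst a w y x l h) + sumUpdates u xs (λ l → place a w y l hx))
  ≡⟨ cong (f + p₁ +_) (cong₂ _+_ (sumUpdates-placeFirst z a w y x xs h) (sumUpdates-place z a w y xs hx)) ⟩
    f + p₁ + (f′ + (p₂ + p₃))
  ≡⟨ rearrange f p₁ f′ p₂ p₃ ⟩
    f + p₂ + (f′ + (p₁ + p₃))
  ≡⟨ cong (λ q → f + p₂ + (f′ + q)) (place-+ a w y xs _ _) ⟨
    f + p₂ + (f′ + place a w y xs (λ l → h (x + suc z ∷ l) + sumUpdates u l hx))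
  ∎
  where
  open ≡-Reasoning
  u  = _+ suc z
  hx = h ∘ (x ∷_)
  f  = placeFirst (a + suc z) w (y + suc z) x xs h
  f′ = placeFirst a w y x xs (λ l → sumUpdates u l h)
  p₁ = place a w y xs (h ∘ (x + suc z ∷_))
  p₂ = place (a + suc z) w (y + suc z) xs hx
  p₃ = place a w y xs (λ l → sumUpdates u l hx)
  rearrange : ∀ f p₁ f′ p₂ p₃ → f + p₁ + (f′ + (p₂ + p₃)) ≡ f + p₂ + (f′ + (p₁ + p₃))
  rearrange = solve-∀
  e₁ : ∀ a x z → a + (x + z) ≡ a + z + x
  e₁ = solve-∀
  e₂ : ∀ x z y → x + z + y ≡ x + (y + z)
  e₂ = solve-∀
  first : placeFirst a w y (x + suc z) xs h ≡ f
  first with strip w xs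
  ... | nothing = refl
  ... | just t  = cong₂ (λ p q → p * h (bump q t)) (e₁ a x (suc z)) (e₂ x (suc z) y)

strip-replicate : ∀ w m → strip w (replicate (w + m) 0) ≡ just (replicate m 0)
strip-replicate zero    m = refl
strip-replicate (suc w) m = strip-replicate w m

strip-short : ∀ w xs → length xs < w → strip w xs ≡ nothing
strip-short (suc w) []           p       = refl
strip-short (suc w) (zero ∷ xs)  (s≤s p) = strip-short w xs p
strip-short (suc w) (suc x ∷ xs) p       = refl

place-short : ∀ a w y b h → length b ≤ w → place a w y b h ≡ 0
place-short a w y []       h p = refl
place-short a w y (x ∷ xs) h p rewrite strip-short w xs p =
  place-short a w y xs (h ∘ (x ∷_)) (<⇒≤ p)

-- The car leaves `m` free spots; its block ends up at the right end, where it is dropped, or before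
-- one of them.
place-replicate : ∀ a w y m h →
  place a w y (replicate (suc w + m) 0) h ≡
  a * (h (replicate m 0) + sumUpdates (_+ y) (replicate m 0) h)
place-replicate a w y zero h
  rewrite strip-replicate w 0
        | place-short a w y (replicate (w + 0) 0) (h ∘ (0 ∷_))
            (≤-reflexive (trans (length-replicate (w + 0)) (+-identityʳ w))) =
  lem a (h [])
  where
  lem : ∀ a b → (a + 0) * b + 0 ≡ a * (b + 0)
  lem = solve-∀
place-replicate a w y (suc m) h
  rewrite strip-replicate w (suc m)
        | +-suc w m
        | place-replicate a w y m (h ∘ (0 ∷_)) =
  lem a (h (y ∷ replicate m 0)) (h (0 ∷ replicate m 0)) _
  where
  lem : ∀ a b c d → (a + 0) * b + a * (c + d) ≡ a * (c + (b + d))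
  lem = solve-∀

-- Counting parkings of generalised cars.

-- spots and growth are stored minus one: sumUpdates-place needs a block of positive length,
-- since only a nonzero entry blocks a car from passing over it.
record Car : Set where
  constructor car
  field base spots growth : ℕ

-- `spots` stays because the block was deleted from the row; its length returns as extra
-- preferences.
absorb : ℕ → Car → Car
absorb z (car a w v) = car (a + z) w (v + z)

width : List Car → ℕ
width []                = 0
width (car a w v ∷ cs) = suc w + width cs

count : Gaps → List Car → ℕ
count b []               = 1
count b (car a w v ∷ cs) = place a w (suc v) b (λ l → count l cs)

place-sumUpdates : ∀ a w y b (f : A → A) cs (H : Gaps → List A → ℕ) →
  place a w y b (λ l → sumUpdates f cs (H l)) ≡
  sumUpdates f cs (λ ds → place a w y b (λ l → H l ds))
place-sumUpdates a w y b f []       H = place-0 a w y b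
place-sumUpdates a w y b f (c ∷ cs) H =
  trans (place-+ a w y b _ _)
        (cong (_ +_) (place-sumUpdates a w y b f cs (λ l ds → H l (c ∷ ds))))

-- By `sumUpdates-place`, each car in turn absorbs the block or leaves it before a spot still free.
-- As the cars fill the row exactly, one of them absorbs it in the end.
count-insert : ∀ z b cs → length b ≡ width cs →
  sumUpdates (_+ suc z) b (λ l → count l cs) ≡ sumUpdates (absorb (suc z)) cs (count b)
-- No free spot is left for a block to precede: both sums are empty.
count-insert z []  []               p = refl
count-insert z b   (car a w v ∷ cs) p =
  trans (sumUpdates-place z a w (suc v) b (λ l → count l cs))
        (cong (place (a + suc z) w (suc v + suc z) b (λ l → count l cs) +_)
          (trans (place-cong a w (suc v) b (λ l q → count-insert z l cs
                    (+-cancelˡ-≡ (suc w) _ _ (trans q p))))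
                 (place-sumUpdates a w (suc v) b (absorb (suc z)) cs count)))

-- The closed product formula.

-- Closed form for the total of `arrangements` when a block of length `z` goes to the right end or
-- to any one car (`arrangements-absorb`). Along the list, `z` collects the growths passed.
spread : ℕ → List Car → ℕ
spread z []               = 1
spread z (car a w v ∷ cs) = (z + (2 + length cs) * a) * spread (z + suc v) cs

arrangements : List Car → ℕ
arrangements []               = 1
arrangements (car a w v ∷ cs) = a * spread (suc v) cs

-- The first car's factor `K` occurs `1 + m` times by induction and once more raised by
-- `(2 + m) * z`; together this is `(2 + m) * (K + z)`.
spread-absorb : ∀ y z cs →
  spread y cs + sumUpdates (absorb z) cs (spread y) ≡ (1 + length cs) * spread (y + z) cs
spread-absorb y z []               = refl
spread-absorb y z (car a w v ∷ cs) =
  begin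
    K * s + ((y + (2 + m) * (a + z)) * spread (y + suc (v + z)) cs
      + sumUpdates (absorb z) cs (λ ds → (y + (2 + length ds) * a) * spread (y + suc v) ds))
  ≡⟨ cong (K * s +_) (cong₂ _+_ (cong ((y + (2 + m) * (a + z)) *_) (cong (λ q → spread q cs) (e₁ y v z)))
       -- Absorbing keeps the number of cars, so `K` is a common factor.
       (trans (sumUpdates-length cs (λ k t → (y + (2 + k) * a) * t) (spread (y + suc v)))
              (sumUpdates-* (absorb z) cs K (spread (y + suc v))))) ⟩
    K * s + ((y + (2 + m) * (a + z)) * s′ + K * R)
  ≡⟨ e₂ K s _ R ⟩
    K * (s + R) + (y + (2 + m) * (a + z)) * s′
  ≡⟨ cong (λ q → K * q + (y + (2 + m) * (a + z)) * s′)
       (trans (spread-absorb (y + suc v) z cs)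
              (cong (λ q → (1 + m) * spread q cs) (e₄ y v z))) ⟩
    K * ((1 + m) * s′) + (y + (2 + m) * (a + z)) * s′
  ≡⟨ e₃ y z m a s′ ⟩
    (2 + m) * ((y + z + (2 + m) * a) * s′)
  ∎
  where
  open ≡-Reasoning
  m  = length cs
  K  = y + (2 + m) * a
  s  = spread (y + suc v) cs
  s′ = spread (y + z + suc v) cs
  R  = sumUpdates (absorb z) cs (spread (y + suc v))
  e₁ : ∀ y v z → y + suc (v + z) ≡ y + z + suc v
  e₁ = solve-∀
  e₄ : ∀ y v z → y + suc v + z ≡ y + z + suc v
  e₄ = solve-∀
  e₂ : ∀ K s t R → K * s + (t + K * R) ≡ K * (s + R) + t
  e₂ = solve-∀
  e₃ : ∀ y z m a s → (y + (2 + m) * a) * ((1 + m) * s) + (y + (2 + m) * (a + z)) * s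
     ≡ (2 + m) * ((y + z + (2 + m) * a) * s)
  e₃ = solve-∀
  sumUpdates-length : ∀ cs (F : ℕ → ℕ → ℕ) (h : List Car → ℕ) →
    sumUpdates (absorb z) cs (λ ds → F (length ds) (h ds)) ≡
    sumUpdates (absorb z) cs (λ ds → F (length cs) (h ds))
  sumUpdates-length []       F h = refl
  sumUpdates-length (c ∷ cs) F h =
    cong (F (suc (length cs)) (h (absorb z c ∷ cs)) +_) (sumUpdates-length cs (F ∘ suc) (h ∘ (c ∷_)))

-- `spread-absorb` supplies `1 + length cs` copies of `a`, and the first car absorbing the block
-- supplies `a + z`.
arrangements-absorb : ∀ z cs →
  arrangements cs + sumUpdates (absorb z) cs arrangements ≡ spread z cs
arrangements-absorb z []               = refl
arrangements-absorb z (car a w v ∷ cs) =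
  begin
    a * s + ((a + z) * spread (suc v + z) cs + sumUpdates (absorb z) cs (λ ds → a * spread (suc v) ds))
  ≡⟨ cong (λ q → a * s + ((a + z) * spread (suc v + z) cs + q)) (sumUpdates-* (absorb z) cs a (spread (suc v))) ⟩
    a * s + ((a + z) * spread (suc v + z) cs + a * R)
  ≡⟨ e₁ a s z (spread (suc v + z) cs) R ⟩
    a * (s + R) + (a + z) * spread (suc v + z) cs
  ≡⟨ cong (λ q → a * q + (a + z) * spread (suc v + z) cs) (spread-absorb (suc v) z cs) ⟩
    a * ((1 + length cs) * spread (suc v + z) cs) + (a + z) * spread (suc v + z) cs
  ≡⟨ e₂ a z (length cs) (spread (suc v + z) cs) ⟩
    (z + (2 + length cs) * a) * spread (suc v + z) cs
  ≡⟨ cong (λ q → (z + (2 + length cs) * a) * spread q cs) (+-comm (suc v) z) ⟩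
    (z + (2 + length cs) * a) * spread (z + suc v) cs
  ∎
  where
  open ≡-Reasoning
  s = spread (suc v) cs
  R = sumUpdates (absorb z) cs (spread (suc v))
  e₁ : ∀ a s z t R → a * s + ((a + z) * t + a * R) ≡ a * (s + R) + (a + z) * t
  e₁ = solve-∀
  e₂ : ∀ a z m t → a * ((1 + m) * t) + (a + z) * t ≡ (z + (2 + m) * a) * t
  e₂ = solve-∀

sumUpdates-absorb-cong : ∀ z cs {g h : List Car → ℕ} →
  (∀ ds → length ds ≡ length cs → width ds ≡ width cs → g ds ≡ h ds) →
  sumUpdates (absorb z) cs g ≡ sumUpdates (absorb z) cs h
sumUpdates-absorb-cong z []       e = refl
sumUpdates-absorb-cong z (car a w v ∷ cs) e =
  cong₂ _+_ (e _ refl refl)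
    (sumUpdates-absorb-cong z cs (λ ds p q → e (car a w v ∷ ds) (cong suc p) (cong (suc w +_) q)))

-- Once the first car is parked, `count-insert` hands its block to a later car and leaves an empty
-- row again. The recursion is on `n` because the modified lists `ds` are not sublists of `cs`.
count-replicate : ∀ n cs → length cs ≡ n → count (replicate (width cs) 0) cs ≡ arrangements cs
count-replicate n       []               p = refl
count-replicate (suc n) (car a w v ∷ cs) p =
  trans (place-replicate a w (suc v) (width cs) (λ l → count l cs))
        (cong (a *_) (trans (cong₂ _+_ (count-replicate n cs (suc-injective p)) updates)
                            (arrangements-absorb (suc v) cs)))
  where
  updates : sumUpdates (_+ suc v) (replicate (width cs) 0) (λ l → count l cs)
          ≡ sumUpdates (absorb (suc v)) cs arrangements
  updates = trans (count-insert v (replicate (width cs) 0) cs (length-replicate (width cs)))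
    (sumUpdates-absorb-cong (suc v) cs λ ds p′ q →
      trans (cong (λ m → count (replicate m 0) ds) (sym q))
            (count-replicate n ds (trans p′ (suc-injective p))))

-- From occupancies of the row to lists of gaps.

sumTo : ℕ → (ℕ → ℕ) → ℕ
sumTo zero    F = 0
sumTo (suc n) F = F 0 + sumTo n (F ∘ suc)

sumTo-cong : ∀ n {F G : ℕ → ℕ} → (∀ i → F i ≡ G i) → sumTo n F ≡ sumTo n G
sumTo-cong zero    e = refl
sumTo-cong (suc n) e = cong₂ _+_ (e 0) (sumTo-cong n (e ∘ suc))

Fin↔ : ∀ {m n} → m ≡ n → Fin m ↔ Fin n
Fin↔ refl = ↔-refl

-- r is the length of the occupied run that ends just before spot k.
gaps : Occupancy → (k f r : ℕ) → Gaps
gaps occ k zero    r = []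
gaps occ k (suc f) r = if occ k then gaps occ (suc k) f (suc r) else r ∷ gaps occ (suc k) f 0

gaps-cong : ∀ {o occ : Occupancy} k f r → (∀ i → k ≤ i → o i ≡ occ i) → gaps o k f r ≡ gaps occ k f r
gaps-cong k zero r e = refl
gaps-cong {occ = occ} k (suc f) r e rewrite e k ≤-refl with occ k
... | true  = gaps-cong (suc k) f (suc r) (λ i p → e i (<⇒≤ p))
... | false = cong (r ∷_) (gaps-cong (suc k) f 0 (λ i p → e i (<⇒≤ p)))

gaps-bump : ∀ occ k f r c → gaps occ k f (r + c) ≡ bump c (gaps occ k f r)
gaps-bump occ k zero    r c = refl
gaps-bump occ k (suc f) r c with occ k
... | true  = gaps-bump occ (suc k) f (suc r) c
... | false = refl

gaps-skip : ∀ occ k f r w → w ≤ f → (∀ i → k ≤ i → i < k + w → occ i ≡ true) →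
  gaps occ k f r ≡ gaps occ (k + w) (f ∸ w) (w + r)
gaps-skip occ k f       r zero    p       e = cong (λ j → gaps occ j f r) (sym (+-identityʳ k))
gaps-skip occ k (suc f) r (suc w) (s≤s p) e
  rewrite e k ≤-refl (m<m+n k (s≤s z≤n)) =
  trans (gaps-skip occ (suc k) f (suc r) w p
          (λ i q q′ → e i (<⇒≤ q) (subst (i <_) (sym (+-suc k w)) q′)))
        (cong₂ (λ j t → gaps occ j (f ∸ w) t) (sym (+-suc k w)) (+-suc w r))

strip-run : ∀ occ k f r w → strip (suc w) (gaps occ k f (suc r)) ≡ nothing
strip-run occ k zero    r w = refl
strip-run occ k (suc f) r w with occ k
... | true  = strip-run occ (suc k) f (suc r) w
... | false = refl

≤ᵇ-suc : ∀ m n → (suc m ≤ᵇ suc n) ≡ (m ≤ᵇ n)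
≤ᵇ-suc zero    n = refl
≤ᵇ-suc (suc m) n = refl

≤ᵇ-+ˡ : ∀ k m n → (k + m ≤ᵇ k + n) ≡ (m ≤ᵇ n)
≤ᵇ-+ˡ zero    m n = refl
≤ᵇ-+ˡ (suc k) m n = trans (≤ᵇ-suc (k + m) (k + n)) (≤ᵇ-+ˡ k m n)

-- A zero entry means that the next spot is free; an occupied one makes the entry nonzero or, up to
-- the right end, leaves none (`strip-run`).
strip-gaps : ∀ occ k f w → strip w (gaps occ k f 0) ≡
  (if allFree occ k w ∧ (w ≤ᵇ f) then just (gaps occ (k + w) (f ∸ w) 0) else nothing)
strip-gaps occ k f       zero    = cong (λ j → just (gaps occ j f 0)) (sym (+-identityʳ k))
strip-gaps occ k zero    (suc w) rewrite ∧-zeroʳ (not (occ k) ∧ allFree occ (suc k) w) = refl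
strip-gaps occ k (suc f) (suc w) with occ k
... | true  = strip-run occ (suc k) f 0 w
... | false rewrite ≤ᵇ-suc w f | +-suc k w = strip-gaps occ (suc k) f w

occupy-before : ∀ occ k s i → i < k → occupy occ k s i ≡ occ i
occupy-before occ k s i p rewrite dec-false (k ≤? i) (<⇒≱ p) = ∨-identityʳ (occ i)

occupy-after : ∀ occ k s i → k + s ≤ i → occupy occ k s i ≡ occ i
occupy-after occ k s i p
  rewrite dec-false (i <? k + s) (≤⇒≯ p) | ∧-zeroʳ (k ≤ᵇ i) = ∨-identityʳ (occ i)

occupy-inside : ∀ occ k s i → k ≤ i → i < k + s → occupy occ k s i ≡ true
occupy-inside occ k s i p q
  rewrite dec-true (k ≤? i) p | dec-true (i <? k + s) q = ∨-zeroʳ (occ i)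

-- The run of length `r`, the car and any run right after it merge into one.
gaps-occupy : ∀ occ k f r w → w ≤ f →
  gaps (occupy occ k (suc w)) k (suc f) r ≡ bump (r + suc w) (gaps occ (suc k + w) (f ∸ w) 0)
gaps-occupy occ k f r w p =
  trans (gaps-skip _ k (suc f) r (suc w) (s≤s p) (occupy-inside occ k (suc w)))
  (trans (gaps-cong (k + suc w) (f ∸ w) (suc w + r) (occupy-after occ k (suc w)))
  (trans (cong₂ (λ j t → gaps occ j (f ∸ w) t) (+-suc k w) (+-comm (suc w) r))
         (gaps-bump occ (suc k + w) (f ∸ w) 0 (r + suc w))))

-- Preferences of the next car.

parkAt : ℕ → Occupancy → ℕ → (Occupancy → ℕ) → ℕ → ℕ
parkAt S occ s G j = if allFree occ j s ∧ (j + s ≤ᵇ suc S) then G (occupy occ j s) else 0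

parkFrom : ℕ → Occupancy → ℕ → (Occupancy → ℕ) → ℕ → ℕ → ℕ
parkFrom S occ s G k f = maybe′ (parkAt S occ s G) 0 (firstEmpty occ k f)

parkAt-placeFirst : ∀ S occ w G k f r (h : Gaps → ℕ) → k + suc f ≡ suc S → occ k ≡ false →
  G (occupy occ k (suc w)) ≡ h (gaps (occupy occ k (suc w)) k (suc f) r) →
  suc r * parkAt S occ (suc w) G k ≡ placeFirst 1 w (suc w) r (gaps occ (suc k) f 0) h
parkAt-placeFirst S occ w G k f r h p free e
  -- As `k + suc f` is `suc S`, the bound on the car's end becomes `w ≤ᵇ f`.
  rewrite cong (λ b → not b ∧ allFree occ (suc k) w) free | sym p | ≤ᵇ-+ˡ k (suc w) (suc f) | ≤ᵇ-suc w f | strip-gaps occ (suc k) f w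
  with allFree occ (suc k) w | w ≤ᵇ f in eq
... | false | _     = *-zeroʳ (suc r)
... | true  | false = *-zeroʳ (suc r)
... | true  | true  = cong (suc r *_) (trans e (cong h
      (gaps-occupy occ k f r w (≤ᵇ⇒≤ w f (subst T (sym eq) tt)))))

-- A preferred spot inside a run parks the car right after the run: the r preferences
-- of the run before spot k have the same effect as k itself.
sumTo-parkFrom : ∀ S occ w G k f r (h : Gaps → ℕ) → k + f ≡ suc S →
  (∀ o → (∀ i → i < k → o i ≡ occ i) → G o ≡ h (gaps o k f r)) →
  sumTo f (λ i → parkFrom S occ (suc w) G (i + k) (f ∸ i)) + r * parkFrom S occ (suc w) G k f ≡
  place 1 w (suc w) (gaps occ k f r) h
sumTo-parkFrom S occ w G k zero    r h p e = *-zeroʳ r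
sumTo-parkFrom S occ w G k (suc f) r h p e with occ k in eq
... | true  =
  trans (lem (parkFrom S occ (suc w) G (suc k) f) _ r)
  (trans (cong (_+ suc r * parkFrom S occ (suc w) G (suc k) f)
           (sumTo-cong f (λ i → cong (λ j → parkFrom S occ (suc w) G j (f ∸ i)) (sym (+-suc i k)))))
         (sumTo-parkFrom S occ w G (suc k) f (suc r) h (trans (sym (+-suc k f)) p) below))
  where
  lem : ∀ x y r → x + y + r * x ≡ y + suc r * x
  lem = solve-∀
  below : ∀ o → (∀ i → i < suc k → o i ≡ occ i) → G o ≡ h (gaps o (suc k) f (suc r))
  below o q with e o (λ i t → q i (m<n⇒m<1+n t))
  ... | t rewrite trans (q k ≤-refl) eq = t
... | false =
  trans (lem (parkAt S occ (suc w) G k) _ r)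
  (cong₂ _+_
    -- Parking at `k` leaves the earlier spots unchanged, so `e` applies to the new row.
    (parkAt-placeFirst S occ w G k f r h p eq (e _ (occupy-before occ k (suc w))))
    (trans (cong (_+ 0)
             (sumTo-cong f (λ i → cong (λ j → parkFrom S occ (suc w) G j (f ∸ i)) (sym (+-suc i k)))))
           (sumTo-parkFrom S occ w G (suc k) f 0 (h ∘ (r ∷_)) (trans (sym (+-suc k f)) p) below)))
  where
  lem : ∀ x y r → x + y + r * x ≡ suc r * x + (y + 0)
  lem = solve-∀
  below : ∀ o → (∀ i → i < suc k → o i ≡ occ i) → G o ≡ h (r ∷ gaps o (suc k) f 0)
  below o q with e o (λ i t → q i (m<n⇒m<1+n t))
  ... | t rewrite trans (q k ≤-refl) eq = t

-- Counting all completions.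

completions : ∀ {n} → ℕ → Occupancy → Vec ℕ n → ℕ
completions S occ []       = 1
completions S occ (y ∷ ys) =
  sumTo S (λ c → parkFrom S occ y (λ o → completions S o ys) (suc c) (S ∸ c))

-- Base 1: a start after a run of length `x` is reached from the run's `x` spots and from itself.
cars : ∀ {n} → Vec ℕ n → List Car
cars []       = []
cars (y ∷ ys) = car 1 (y ∸ 1) (y ∸ 1) ∷ cars ys

completions≡count : ∀ {n} S occ {ys : Vec ℕ n} → All (1 ≤_) ys →
  completions S occ ys ≡ count (gaps occ 1 S 0) (cars ys)
completions≡count S occ []                     = refl
completions≡count S occ {suc w ∷ ys} (p ∷ ps) =
  trans (sumTo-cong S (λ c → cong (λ j → parkFrom S occ (suc w) G j (S ∸ c)) (+-comm 1 c)))
  -- At spot 1 the incoming run has length 0, so the extra term vanishes.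
  (trans (sym (+-identityʳ _))
         (sumTo-parkFrom S occ w G 1 S 0 (λ l → count l (cars ys)) refl
           (λ o _ → completions≡count S o ps)))
  where
  G : Occupancy → ℕ
  G o = completions S o ys

-- Bijections with finite sets.

¬↔Fin0 : ¬ A → A ↔ Fin 0
¬↔Fin0 ¬a = mk↔ₛ′ (⊥-elim ∘ ¬a) (λ ()) (λ ()) (⊥-elim ∘ ¬a)

Σℕ↔ : (P : ℕ → Set) → Σ ℕ P ↔ (P 0 ⊎ Σ ℕ (P ∘ suc))
Σℕ↔ P = mk↔ₛ′
  (λ { (zero , p) → inj₁ p ; (suc n , p) → inj₂ (n , p) })
  (λ { (inj₁ p) → zero , p ; (inj₂ (n , p)) → suc n , p })
  (λ { (inj₁ p) → refl ; (inj₂ _) → refl })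
  (λ { (zero , p) → refl ; (suc n , p) → refl })

Σℕ↔sumTo : ∀ S (P : ℕ → Set) (F : ℕ → ℕ) → (∀ i → P i ↔ Fin (F i)) → (∀ i → S ≤ i → ¬ P i) →
  Σ ℕ P ↔ Fin (sumTo S F)
Σℕ↔sumTo zero    P F b v = ¬↔Fin0 (λ { (i , p) → v i z≤n p })
Σℕ↔sumTo (suc S) P F b v =
  ↔-trans (Σℕ↔ P) (↔-trans (b 0 ⊎-↔ Σℕ↔sumTo S (P ∘ suc) (F ∘ suc) (b ∘ suc) (λ i p → v (suc i) (s≤s p)))
                           (↔-sym +↔⊎))

ΣVec↔ : ∀ {n} (Q : Vec ℕ (suc n) → Set) → (∀ cs → ¬ Q (0 ∷ cs)) →
  Σ (Vec ℕ (suc n)) Q ↔ Σ ℕ (λ c → Σ (Vec ℕ n) (λ cs → Q (suc c ∷ cs)))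
ΣVec↔ Q ¬Q0 = mk↔ₛ′
  (λ { (zero ∷ cs , q) → ⊥-elim (¬Q0 cs q) ; (suc c ∷ cs , q) → c , cs , q })
  (λ { (c , cs , q) → suc c ∷ cs , q })
  (λ _ → refl)
  (λ { (zero ∷ cs , q) → ⊥-elim (¬Q0 cs q) ; (suc c ∷ cs , q) → refl })

parkAll↔completions : ∀ {n} S occ (ys : Vec ℕ n) →
  Σ (Vec ℕ n) (λ cs → T (parkAll S occ ys cs)) ↔ Fin (completions S occ ys)
parkAll↔completions S occ [] =
  ↔-trans (mk↔ₛ′ _ (λ _ → [] , tt) (λ _ → refl) (λ { ([] , tt) → refl })) (↔-sym 1↔⊤)
parkAll↔completions {suc n} S occ (y ∷ ys) =
  ↔-trans (ΣVec↔ (T ∘ parkAll S occ (y ∷ ys)) (λ _ ()))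
    (Σℕ↔sumTo S _ _ first beyond)
  where
  first : ∀ c → Σ (Vec ℕ n) (λ cs → T (parkAll S occ (y ∷ ys) (suc c ∷ cs))) ↔
    Fin (parkFrom S occ y (λ o → completions S o ys) (suc c) (S ∸ c))
  first c with firstEmpty occ (suc c) (S ∸ c)
  ... | nothing = ¬↔Fin0 proj₂
  ... | just j with allFree occ j y ∧ (j + y ≤ᵇ suc S)
  ...   | true  = parkAll↔completions S (occupy occ j y) ys
  ...   | false = ¬↔Fin0 proj₂
  beyond : ∀ c → S ≤ c → ¬ Σ (Vec ℕ n) (λ cs → T (parkAll S occ (y ∷ ys) (suc c ∷ cs)))
  -- The search has `S ∸ c`, that is 0, spots to inspect and fails.
  beyond c p (cs , t) rewrite m≤n⇒m∸n≡0 p = t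

-- Specialisation to the given car sizes.

gaps-empty : ∀ k f → gaps empty k f 0 ≡ replicate f 0
gaps-empty k zero    = refl
gaps-empty k (suc f) = cong (0 ∷_) (gaps-empty (suc k) f)

width-cars : ∀ {n} {ys : Vec ℕ n} → All (1 ≤_) ys → width (cars ys) ≡ sum (toList ys)
width-cars []              = refl
width-cars (s≤s {n = v} z≤n ∷ ps) = cong (suc v +_) (width-cars ps)

length-cars : ∀ {n} (ys : Vec ℕ n) → length (cars ys) ≡ n
length-cars []       = refl
length-cars (y ∷ ys) = cong suc (length-cars ys)

applyUpTo-cong : ∀ {f g : ℕ → A} → (∀ i → f i ≡ g i) → ∀ n → applyUpTo f n ≡ applyUpTo g n
applyUpTo-cong e zero    = refl
applyUpTo-cong e (suc n) = cong₂ _∷_ (e 0) (applyUpTo-cong (e ∘ suc) n)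

-- All bases are 1, so each factor is `z` plus the sizes passed plus one more than the number of
-- cars left, the current one included.
spread-cars : ∀ {n} z {ys : Vec ℕ n} → All (1 ≤_) ys →
  spread z (cars ys) ≡ product (applyUpTo (λ i → z + prefixSum ys i + (n + 1 ∸ i)) n)
spread-cars z [] = refl
spread-cars {suc n} z {suc v ∷ ys} (s≤s z≤n ∷ ps) = cong₂ _*_
  (trans (cong (λ m → z + (2 + m) * 1) (length-cars ys)) (lem z n))
  (trans (spread-cars (z + suc v) ps)
         (cong product (applyUpTo-cong
           (λ i → cong (_+ (n + 1 ∸ i)) (+-assoc z (suc v) (prefixSum ys i))) n)))
  where
  lem : ∀ z n → z + (2 + n) * 1 ≡ z + 0 + (suc n + 1)
  lem = solve-∀

-- The first car contributes only its base 1, so `n` factors remain for `suc n` cars.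
arrangements-cars : ∀ {n} {ys : Vec ℕ (suc n)} → All (1 ≤_) ys →
  arrangements (cars ys) ≡ parkingFormula ys
arrangements-cars {n} {suc v ∷ ys} (s≤s z≤n ∷ ps) =
  trans (*-identityˡ _) (trans (spread-cars (suc v) ps)
    (cong product (sym (map-applyUpTo suc (λ i → prefixSum (suc v ∷ ys) i + (suc n + 1 ∸ i)) n))))

theorem1 : (n : ℕ) → 1 ≤ n → (ys : Vec ℕ n) → All (1 ≤_) ys →
    Σ (Vec ℕ n) (λ cs → T (isParkingSeq ys cs)) ↔ Fin (parkingFormula ys)
theorem1 (suc n) _ ys ps = ↔-trans (parkAll↔completions S empty ys) (Fin↔ (begin
  completions S empty ys                             ≡⟨ completions≡count S empty ps ⟩
  count (gaps empty 1 S 0) (cars ys)                 ≡⟨ cong (λ b → count b (cars ys)) (gaps-empty 1 S) ⟩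
  -- The sizes add up to the row length, so the cars fill it exactly, as `count-replicate` requires.
  count (replicate S 0) (cars ys)                    ≡⟨ cong (λ m → count (replicate m 0) (cars ys)) (width-cars ps) ⟨
  count (replicate (width (cars ys)) 0) (cars ys)    ≡⟨ count-replicate (suc n) (cars ys) (length-cars ys) ⟩
  arrangements (cars ys)                             ≡⟨ arrangements-cars ps ⟩
  parkingFormula ys                                  ∎))
  where
  open ≡-Reasoning
  S = sum (toList ys)
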